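{- Let $G$ be a graph of order $n$ with chromatic number $\chi(G)=k$. Then $\tau(G) \leq k(f(n/k)+1)-1$. Moreover, this bound is sharp for all $k$: for every integer $k\geq 1$ there exist an integer $n$ and a graph $G$ of order $n$ with $\chi(G)=k$ such that $\tau(G)=k(f(n/k)+1)-1$.
   Context: Graphs are finite, simple, undirected and have at least one vertex; the order of a graph is its number of vertices; $d_G(x,y)$ is the distance between $x$ and $y$ in $G$ (equal to $\infty$ if $x$ and $y$ lie in different components). A vertex $w$ resolves a pair of vertices $u,v$ if $d_G(u,w)\neq d_G(v,w)$. A set $W\subseteq V(G)$ is a resolving set for $G$ if every pair of distinct vertices of $G$ is resolved by some vertex of $W$. The metric dimension $\beta(G)$ is the minimum cardinality of a resolving set for $G$ (with $\beta(K_1)=0$). The threshold dimension is $\tau(G)=\min\{\beta(H): H \text{ contains } G \text{ as a spanning subgraph}\}$, i.e. the minimum metric dimension among all graphs $H$ with $V(H)=V(G)$ and $E(G)\subseteq E(H)$. The function $f:[1,\infty)\to\mathbb{N}$ is defined by letting $f(x)$ be the smallest integer $d$ such that $2^d+d>x$; equivalently, $f(x)=d$ if and only if $x\in[2^{d-1}+d-1,\,2^d+d)$, where $d\ge 1$. -}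

module Defs where

open import Data.Bool.Base using (Bool; true; false; T)
open import Data.Bool.Properties using (T?) renaming (_≟_ to _≟ᵇ_)
open import Data.Empty using (⊥-elim)
open import Data.Fin.Base as Fin using (Fin; zero; suc)
import Data.Fin.Properties as Fin
open import Data.Fin.Subset using (Subset; _∈_; ∣_∣; ⊤)
open import Data.Fin.Subset.Properties using (_∈?_; anySubset?; ∈⊤)
open import Data.Integer.Base as ℤ using (+_)
import Data.Integer.Properties as ℤ
open import Data.Nat.Base
open import Data.Nat.Induction using (<-rec)
open import Data.Nat.Properties
open import Data.Product using (Σ; Σ-syntax; ∃; ∃-syntax; _×_; _,_; proj₁; proj₂)
open import Data.Rational.Base as ℚ using (ℚ; ↥_; ↧_; ↧ₙ_)
import Data.Rational.Properties as ℚ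
import Data.Rational.Unnormalised.Base as ℚᵘ
import Data.Rational.Unnormalised.Properties as ℚᵘ
open import Data.Sum.Base using (_⊎_; inj₁; inj₂)
open import Function.Base using (_∘_; id)
open import Relation.Binary.Core using (Rel)
open import Relation.Binary.Definitions using (Reflexive)
open import Relation.Binary.PropositionalEquality
open import Relation.Nullary using (¬_; Dec; yes; no; contradiction)
open import Relation.Nullary.Construct.Add.Supremum using (_⁺; ⊤⁺; [_]; []-injective; ≡-dec)
open import Relation.Nullary.Decidable using (map′; _×-dec_; _→-dec_; ¬?)
open import Relation.Unary using (Pred; Decidable)
open import Level using (0ℓ)

IsMinimum : Pred ℕ 0ℓ → ℕ → Set
IsMinimum P m = P m × (∀ j → P j → m ≤ j)

Minimum : Pred ℕ 0ℓ → Set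
Minimum P = ∃ (IsMinimum P)

isMinimum-unique : ∀ {P Q : Pred ℕ 0ℓ} → (∀ {j} → P j → Q j) → (∀ {j} → Q j → P j) →
                   ∀ {m m′} → IsMinimum P m → IsMinimum Q m′ → m ≡ m′
isMinimum-unique P⇒Q Q⇒P (p , p-min) (q , q-min) =
  ≤-antisym (p-min _ (Q⇒P q)) (q-min _ (P⇒Q p))

minimum : ∀ {P : Pred ℕ 0ℓ} → Decidable P → ∃ P → Minimum P
minimum {P} P? (m , pm) with below (suc m)
  where
  below : ∀ b → Minimum P ⊎ (∀ j → j < b → ¬ P j)
  below zero    = inj₂ λ _ ()
  below (suc b) with below b
  ... | inj₁ found = inj₁ found
  ... | inj₂ none with P? b
  ...   | yes pb = inj₁ (b , pb , λ j pj → ≮⇒≥ λ j<b → none j j<b pj)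
  ...   | no ¬pb = inj₂ λ j j<1+b pj → case-≤ (m<1+n⇒m<n∨m≡n j<1+b) pj
    where
    case-≤ : ∀ {j} → j < b ⊎ j ≡ b → ¬ P j
    case-≤ (inj₁ j<b)  = none _ j<b
    case-≤ (inj₂ refl) = ¬pb
... | inj₁ found = found
... | inj₂ none  = contradiction pm (none m (n<1+n m))

-- Graphs of order n, with vertex set Fin n.
record Graph (n : ℕ) : Set where
  field
    {{nonEmpty}} : NonZero n
    adj          : Fin n → Fin n → Bool
    symmetric    : ∀ u v → adj u v ≡ adj v u
    irreflexive  : ∀ u → adj u u ≡ false

  Adj : Fin n → Fin n → Set
  Adj u v = T (adj u v)

open Graph public using (adj; Adj)

_⊆ᴳ_ : ∀ {n} → Graph n → Graph n → Set
G ⊆ᴳ H = ∀ u v → Adj G u v → Adj H u v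

Colourable : ∀ {n} → Graph n → ℕ → Set
Colourable {n} G k =
  Σ[ c ∈ (Fin n → Fin k) ] (∀ u v → Adj G u v → c u ≢ c v)

Walk : ∀ {n} → Graph n → Fin n → Fin n → ℕ → Set
Walk G u v zero    = u ≡ v
Walk G u v (suc ℓ) = ∃[ w ] (Adj G u w × Walk G w v ℓ)

-- ⊤⁺ plays the role of ∞.
IsDistance : ∀ {n} → Graph n → Fin n → Fin n → ℕ ⁺ → Set
IsDistance G u v [ d ] = IsMinimum (Walk G u v) d
IsDistance G u v ⊤⁺    = ∀ ℓ → ¬ Walk G u v ℓ

private
  _++ʷ_ : ∀ {n} {G : Graph n} {u v w} {ℓ m} → Walk G u v ℓ → Walk G v w m → Walk G u w (ℓ + m)
  _++ʷ_ {ℓ = zero}  refl        q = q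
  _++ʷ_ {ℓ = suc ℓ} (x , a , p) q = x , a , _++ʷ_ {ℓ = ℓ} p q

  vertex : ∀ {n} (G : Graph n) {u v} ℓ → Walk G u v ℓ → Fin (suc ℓ) → Fin n
  vertex G {u} ℓ       p           zero    = u
  vertex G     (suc ℓ) (x , a , p) (suc i) = vertex G ℓ p i

  takeʷ : ∀ {n} (G : Graph n) {u v} ℓ (p : Walk G u v ℓ) i →
          Walk G u (vertex G ℓ p i) (Fin.toℕ i)
  takeʷ G ℓ       p           zero    = refl
  takeʷ G (suc ℓ) (x , a , p) (suc i) = x , a , takeʷ G ℓ p i

  dropʷ : ∀ {n} (G : Graph n) {u v} ℓ (p : Walk G u v ℓ) i →
          Walk G (vertex G ℓ p i) v (ℓ ∸ Fin.toℕ i)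
  dropʷ G ℓ       p           zero    = p
  dropʷ G (suc ℓ) (x , a , p) (suc i) = dropʷ G ℓ p i

  shorten : ∀ {n} (G : Graph n) {u v} ℓ → Walk G u v ℓ → ∃[ m ] (m < n × Walk G u v m)
  shorten {n} G {u} {v} = <-rec _ λ ℓ rec p → step ℓ rec p (ℓ <? n)
    where
    step : ∀ ℓ → (∀ {m} → m < ℓ → Walk G u v m → ∃[ k ] (k < n × Walk G u v k)) →
           Walk G u v ℓ → Dec (ℓ < n) → ∃[ m ] (m < n × Walk G u v m)
    step ℓ rec p (yes ℓ<n) = ℓ , ℓ<n , p
    step ℓ rec p (no ℓ≮n)
      with i , j , i<j , eq ← Fin.pigeonhole (s≤s (≮⇒≥ ℓ≮n)) (vertex G ℓ p)
      = rec shorter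
          (_++ʷ_ {G = G} {ℓ = Fin.toℕ i} (takeʷ G ℓ p i)
            (subst (λ x → Walk G x v (ℓ ∸ Fin.toℕ j)) (sym eq) (dropʷ G ℓ p j)))
      where
      shorter : Fin.toℕ i + (ℓ ∸ Fin.toℕ j) < ℓ
      shorter = <-≤-trans (+-monoˡ-< (ℓ ∸ Fin.toℕ j) i<j)
                  (≤-reflexive (m+[n∸m]≡n (s≤s⁻¹ (Fin.toℕ<n j))))

  walk? : ∀ {n} (G : Graph n) u v → Decidable (Walk G u v)
  walk? G u v zero    = u Fin.≟ v
  walk? G u v (suc ℓ) = Fin.any? λ w → T? (adj G u w) ×-dec walk? G w v ℓ

opaque
  distance : ∀ {n} (G : Graph n) u v → ∃ (IsDistance G u v)
  distance {n} G u v with anyUpTo? (walk? G u v) n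
  ... | yes (ℓ , _ , p) = let m , m-min = minimum (walk? G u v) (ℓ , p) in [ m ] , m-min
  ... | no none         = ⊤⁺ , λ ℓ p → none (shorten G ℓ p)

dist : ∀ {n} → Graph n → Fin n → Fin n → ℕ ⁺
dist G u v = proj₁ (distance G u v)

isDistance-unique : ∀ {n} (G H : Graph n) → (∀ u v → adj G u v ≡ adj H u v) →
                    ∀ {u v} d e → IsDistance G u v d → IsDistance H u v e → d ≡ e
isDistance-unique G H G≗H = unique
  where
  walk⇒ : ∀ (G H : Graph _) → (∀ u v → adj G u v ≡ adj H u v) →
          ∀ ℓ {u v} → Walk G u v ℓ → Walk H u v ℓ
  walk⇒ G H G≗H zero    p           = p
  walk⇒ G H G≗H (suc ℓ) (w , a , p) = w , subst T (G≗H _ w) a , walk⇒ G H G≗H ℓ p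

  to : ∀ {u v ℓ} → Walk G u v ℓ → Walk H u v ℓ
  to {ℓ = ℓ} = walk⇒ G H G≗H ℓ

  from : ∀ {u v ℓ} → Walk H u v ℓ → Walk G u v ℓ
  from {ℓ = ℓ} = walk⇒ H G (λ u v → sym (G≗H u v)) ℓ

  unique : ∀ {u v} d e → IsDistance G u v d → IsDistance H u v e → d ≡ e
  unique [ d ] [ e ] p       q       =
    cong [_] (isMinimum-unique (λ {ℓ} → to {ℓ = ℓ}) (λ {ℓ} → from {ℓ = ℓ}) p q)
  unique [ d ] ⊤⁺    (p , _) q       = contradiction (to {ℓ = d} p) (q d)
  unique ⊤⁺    [ e ] p       (q , _) = contradiction (from {ℓ = e} q) (p e)
  unique ⊤⁺    ⊤⁺    _       _       = refl

dist-cong : ∀ {n} (G H : Graph n) → (∀ u v → adj G u v ≡ adj H u v) →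
            ∀ u v → dist G u v ≡ dist H u v
dist-cong G H G≗H u v =
  isDistance-unique G H G≗H _ _ (proj₂ (distance G u v)) (proj₂ (distance H u v))

Resolves : ∀ {n} → Graph n → Fin n → Fin n → Fin n → Set
Resolves G w u v = dist G u w ≢ dist G v w

Resolving : ∀ {n} → Graph n → Subset n → Set
Resolving G W = ∀ u v → u ≢ v → ∃[ w ] (w ∈ W × Resolves G w u v)

private
  resolving? : ∀ {n} (G : Graph n) → Decidable (Resolving G)
  resolving? G W = Fin.all? λ u → Fin.all? λ v → ¬? (u Fin.≟ v) →-dec
    Fin.any? λ w → (w ∈? W) ×-dec ¬? (≡-dec _≟_ (dist G u w) (dist G v w))

  ⊤-resolving : ∀ {n} (G : Graph n) → Resolving G ⊤
  ⊤-resolving G u v u≢v = v , ∈⊤ , λ eq → u≢v (u≡v (trans eq (isDistance-unique G G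
      (λ _ _ → refl) _ [ 0 ] (proj₂ (distance G v v)) (refl , λ _ _ → z≤n)))
      (proj₂ (distance G u v)))
    where
    u≡v : ∀ {d} → d ≡ [ 0 ] → IsDistance G u v d → u ≡ v
    u≡v refl (p , _) = p

opaque
  β-minimum : ∀ {n} (G : Graph n) → Minimum (λ m → ∃[ W ] (Resolving G W × ∣ W ∣ ≡ m))
  β-minimum G = minimum (λ m → anySubset? λ W → resolving? G W ×-dec (∣ W ∣ ≟ m))
                        (_ , ⊤ , ⊤-resolving G , refl)

β : ∀ {n} → Graph n → ℕ
β G = proj₁ (β-minimum G)

β-cong : ∀ {n} (G H : Graph n) → (∀ u v → adj G u v ≡ adj H u v) → β G ≡ β H
β-cong G H G≗H = isMinimum-unique
  (λ (W , r , eq) → W , transfer G H G≗H r , eq)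
  (λ (W , r , eq) → W , transfer H G (λ u v → sym (G≗H u v)) r , eq)
  (proj₂ (β-minimum G)) (proj₂ (β-minimum H))
  where
  transfer : ∀ (G H : Graph _) → (∀ u v → adj G u v ≡ adj H u v) →
             ∀ {W} → Resolving G W → Resolving H W
  transfer G H G≗H r u v u≢v with w , w∈W , ≢ ← r u v u≢v =
    w , w∈W , λ eq → ≢ (trans (dist-cong G H G≗H u w) (trans eq (sym (dist-cong G H G≗H v w))))

-- There is no function extensionality, so to search through finite function
-- spaces the predicates have to respect pointwise equality.
private
  Search : ∀ {A : Set} → Rel A 0ℓ → Set₁
  Search {A} _≈_ = ∀ {P : Pred A 0ℓ} → (∀ {x y} → x ≈ y → P x → P y) → Decidable P → Dec (∃ P)

  search-Bool : Search {Bool} _≡_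
  search-Bool _ P? with P? true | P? false
  ... | yes p | _     = yes (true , p)
  ... | _     | yes p = yes (false , p)
  ... | no ¬p | no ¬q = no λ { (true , p) → ¬p p ; (false , q) → ¬q q }

  infixr 5 _∷ᶠ_
  _∷ᶠ_ : ∀ {A : Set} {n} → A → (Fin n → A) → Fin (suc n) → A
  (a ∷ᶠ g) zero    = a
  (a ∷ᶠ g) (suc i) = g i

  search-→ : ∀ {A : Set} (_≈_ : Rel A 0ℓ) → Reflexive _≈_ → Search _≈_ →
             ∀ n → Search {Fin n → A} (λ g h → ∀ i → g i ≈ h i)
  search-→ _≈_ rfl s zero    resp P? = map′ (λ p → _ , p) (λ (g , p) → resp {g} (λ ()) p) (P? λ ())
  search-→ _≈_ rfl s (suc n) {P} resp P? =
    map′ (λ (a , g , p) → a ∷ᶠ g , p)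
         (λ (g , p) → g zero , g ∘ suc , resp {g} (λ { zero → rfl ; (suc i) → rfl }) p)
         (s {λ a → ∃[ g ] P (a ∷ᶠ g)}
            (λ {a} {b} a≈b (g , p) → g , resp {a ∷ᶠ g} {b ∷ᶠ g} (λ { zero → a≈b ; (suc i) → rfl }) p)
            (λ a → search-→ _≈_ rfl s n
                     (λ {g} {h} g≈h → resp {a ∷ᶠ g} {a ∷ᶠ h} λ { zero → rfl ; (suc i) → g≈h i })
                     (λ g → P? (a ∷ᶠ g))))

  anyGraph? : ∀ {n} → NonZero n → {P : Pred (Graph n) 0ℓ} →
              (∀ {G H} → (∀ u v → adj G u v ≡ adj H u v) → P G → P H) →
              Decidable P → Dec (∃ P)
  anyGraph? {n} n≢0 {P} resp P? =
    map′ (λ (a , s , i , p) → mk a s i , p)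
         (λ (G , p) → adj G , Graph.symmetric G , Graph.irreflexive G ,
                      resp (λ _ _ → refl) p)
         (search-→ (λ g h → ∀ i → g i ≡ h i) (λ _ → refl) (search-→ _≡_ refl search-Bool n) n respQ Q?)
    where
    mk : (a : Fin n → Fin n → Bool) → (∀ u v → a u v ≡ a v u) → (∀ u → a u u ≡ false) → Graph n
    mk a s i = record { nonEmpty = n≢0 ; adj = a ; symmetric = s ; irreflexive = i }

    Q : Pred (Fin n → Fin n → Bool) 0ℓ
    Q a = Σ[ s ∈ (∀ u v → a u v ≡ a v u) ] Σ[ i ∈ (∀ u → a u u ≡ false) ] P (mk a s i)

    respQ : ∀ {a b} → (∀ u v → a u v ≡ b u v) → Q a → Q b
    respQ a≗b (s , i , p) =
      (λ u v → trans (sym (a≗b u v)) (trans (s u v) (a≗b v u))) ,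
      (λ u → trans (sym (a≗b u u)) (i u)) ,
      resp a≗b p

    Q? : Decidable Q
    Q? a with Fin.all? (λ u → Fin.all? λ v → a u v ≟ᵇ a v u)
            | Fin.all? (λ u → a u u ≟ᵇ false)
    ... | no ¬s | _     = no λ (s , _) → ¬s s
    ... | yes _ | no ¬i = no λ (_ , i , _) → ¬i i
    ... | yes s | yes i = map′ (λ p → s , i , p)
                               (λ (_ , _ , p) → resp (λ _ _ → refl) p)
                               (P? (mk a s i))

opaque
  τ-minimum : ∀ {n} (G : Graph n) → Minimum (λ m → ∃[ H ] (G ⊆ᴳ H × β H ≡ m))
  τ-minimum {n} G = minimum
    (λ m → anyGraph? (Graph.nonEmpty G)
      (λ {H} {K} H≗K (G⊆H , eq) → (λ u v → subst T (H≗K u v) ∘ G⊆H u v) ,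
                                  trans (sym (β-cong H K H≗K)) eq)
      (λ H → (Fin.all? λ u → Fin.all? λ v → T? (adj G u v) →-dec T? (adj H u v))
             ×-dec (β H ≟ m)))
    (β G , G , (λ _ _ → id) , refl)

τ : ∀ {n} → Graph n → ℕ
τ G = proj₁ (τ-minimum G)

opaque
  χ-minimum : ∀ {n} (G : Graph n) → Minimum (Colourable G)
  χ-minimum {n} G = minimum
    (λ k → search-→ _≡_ refl (λ _ → Fin.any?) n
      (λ c≗d proper u v a eq → proper u v a (trans (c≗d u) (trans eq (sym (c≗d v)))))
      (λ c → Fin.all? λ u → Fin.all? λ v → T? (adj G u v) →-dec ¬? (c u Fin.≟ c v)))
    (n , id , λ { u .u a refl → subst T (Graph.irreflexive G u) a })

χ : ∀ {n} → Graph n → ℕ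
χ G = proj₁ (χ-minimum G)

-- Since graphs are nonempty, dividing by the chromatic number is always meaningful.
χ-nonZero : ∀ {n} (G : Graph n) → NonZero (χ G)
χ-nonZero {zero}  G = ⊥-elim (NonZero.nonZero (Graph.nonEmpty G))
χ-nonZero {suc n} G = ≢-nonZero λ eq →
  Fin.¬Fin0 (subst Fin eq (proj₁ (proj₁ (proj₂ (χ-minimum G))) zero))

private
  <2^+ : ∀ x → x ℚ.< + (2 ^ ℤ.∣ ↥ x ∣ + ℤ.∣ ↥ x ∣) ℚ./ 1
  <2^+ x@record{} = ℚ.toℚᵘ-cancel-<
      (ℚᵘ.<-respʳ-≃ (ℚᵘ.≃-sym (ℚ.toℚᵘ-fromℚᵘ (ℚᵘ.mkℚᵘ (+ b) 0))) (ℚᵘ.*<* below))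
    where
    m b : ℕ
    m = ℤ.∣ ↥ x ∣
    b = 2 ^ m + m

    i≤∣i∣ : ∀ i → i ℤ.≤ + ℤ.∣ i ∣
    i≤∣i∣ (+ _)      = ℤ.≤-refl
    i≤∣i∣ ℤ.-[1+ _ ] = ℤ.-≤+

    open ℤ.≤-Reasoning
    below : ↥ x ℤ.* + 1 ℤ.< + b ℤ.* ↧ x
    below = begin-strict
      ↥ x ℤ.* + 1       ≡⟨ ℤ.*-identityʳ (↥ x) ⟩
      ↥ x               ≤⟨ i≤∣i∣ (↥ x) ⟩
      + m               <⟨ ℤ.+<+ (+-monoˡ-≤ m (m^n>0 2 m)) ⟩
      + b               ≤⟨ ℤ.+≤+ (m≤m*n b (↧ₙ x)) ⟩
      + (b * ↧ₙ x)      ≡⟨ ℤ.pos-* b (↧ₙ x) ⟩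
      + b ℤ.* ↧ x       ∎

opaque
  f-minimum : ∀ x → Minimum (λ d → x ℚ.< + (2 ^ d + d) ℚ./ 1)
  f-minimum x = minimum (λ d → x ℚ.<? (+ (2 ^ d + d) ℚ./ 1)) (ℤ.∣ ↥ x ∣ , <2^+ x)

-- Only rational arguments are needed.  For x ≥ 1 the least integer d with
-- 2^d + d > x is positive, because 2^d + d ≤ 1 whenever d ≤ 0; so the minimum
-- may be taken over ℕ.  The values at x < 1 are not meaningful.
f : ℚ → ℕ
f x = proj₁ (f-minimum x)

-- Upper bound.  Fix a proper colouring, join any two vertices of different
-- colours, and let dᵢ be least with mᵢ < 2^dᵢ + dᵢ, where mᵢ is the size of the
-- i-th class.  Take dᵢ vertices of the class as landmarks and give its other
-- vertices distinct neighbourhoods among them, none of which is the whole set of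
-- landmarks of the class; this is possible because mᵢ ∸ dᵢ ≤ 2^dᵢ ∸ 1.  Vertices
-- of one class are told apart by these neighbourhoods, and vertices of different
-- classes by a landmark that is not adjacent to the one in its own class.  Since
-- 2^(dᵢ - 1) + dᵢ - 1 ≤ mᵢ, convexity of 2^x + x bounds the sum of the dᵢ.
--
-- Sharpness.  Take the complete multipartite graph with one class of size 2^k
-- and k - 1 classes of size 2^k + k + 1.  In any supergraph a class with w
-- landmarks has at most w + 2^w vertices, because for k ≥ 2 the distances within
-- a class are at most 2.  This forces k landmarks in the small class and k + 1
-- in each of the others.
module Submission where

open import Defs
open import Data.Nat.Base using (ℕ; NonZero; _+_; _*_; _∸_; _≤_)
open import Data.Nat.Base using (zero; suc; _^_; _<_; z≤n; s≤s; z<s; s<s; s≤s⁻¹; >-nonZero) renaming (_/_ to _÷_; _%_ to _mod_)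
open import Data.Nat.DivMod using (m%n<n; m≡m%n+[m/n]*n; m<n*o⇒m/o<n)
open import Data.Nat.Properties
open import Data.Nat.Solver using (module +-*-Solver)
open import Data.Integer.Base using (+_)
import Data.Integer.Base as ℤ
import Data.Integer.Properties as ℤ
open import Data.Rational.Base using (_/_)
import Data.Rational.Base as ℚ
import Data.Rational.Properties as ℚ
import Data.Rational.Unnormalised.Base as ℚᵘ
import Data.Rational.Unnormalised.Properties as ℚᵘ
open import Data.Bool.Base using (Bool; true; false; T)
open import Data.Bool.Properties using (T?)
open import Data.Fin.Base as Fin using (Fin; zero; suc; toℕ; fromℕ<; join; splitAt; funToFin; finToFun; _↑ˡ_; _↑ʳ_; combine; quotient)
import Data.Fin.Properties as Fin
open import Data.Fin.Subset using (Subset; inside; outside; ⁅_⁆; ⊥; _∪_; ∣_∣) renaming (_∈_ to _∈ˢ_)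
open import Data.Fin.Subset.Properties using (∣⊥∣≡0; ∣⁅x⁆∣≡1; x∈⁅x⁆; x∈p∪q⁺)
open import Data.Vec.Base using ([]; _∷_; here; there)
open import Data.List.Base using (List; []; _∷_; length; lookup; map; filter; tabulate; concat; allFin)
open import Data.Nat.ListAction using (sum)
open import Data.List.Properties using (length-map; length-tabulate; length-++; filter-accept; filter-reject)
open import Data.List.Membership.Propositional using (_∈_)
open import Data.List.Membership.Propositional.Properties using (∈-map⁺; ∈-filter⁺; ∈-filter⁻; ∈-allFin; ∈-tabulate⁺; ∈-concat⁺′; ∈-lookup)
import Data.List.Membership.DecPropositional as DecMembership
open import Data.List.Relation.Unary.Any as Any using (index)
open import Data.List.Relation.Unary.Any.Properties using (lookup-index)
import Data.List.Relation.Unary.All as All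
import Data.List.Relation.Unary.AllPairs as AllPairs
open import Data.List.Relation.Unary.Unique.Propositional using (Unique)
import Data.List.Relation.Unary.Unique.Propositional.Properties as Unique
open import Data.Product using (_×_; ∃-syntax; Σ-syntax; _,_; proj₁; proj₂)
open import Data.Sum.Base using (_⊎_; inj₁; inj₂; swap)
open import Data.Sum.Properties using (inj₁-injective; inj₂-injective)
open import Function.Base using (_∘_; id)
open import Function.Bundles using (mk⇔)
open import Relation.Binary.PropositionalEquality using (_≡_; _≢_; refl; sym; trans; cong; cong₂; subst; subst₂)
open import Relation.Nullary using (¬_; Dec; yes; no; contradiction)
open import Relation.Nullary.Construct.Add.Supremum using ([_])
open import Relation.Nullary.Decidable using (does; does-⇔; _×-dec_; _⊎-dec_; ¬?; dec-false)

-- Distances 0, 1 and 2, and the pairs they resolve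

distance-unique : ∀ {n} (G : Graph n) {u v} d → IsDistance G u v d → dist G u v ≡ d
distance-unique G d p = isDistance-unique G G (λ _ _ → refl) _ d (proj₂ (distance G _ _)) p

adj-irrefl : ∀ {n} (G : Graph n) {u} → ¬ Adj G u u
adj-irrefl G {u} a = subst T (Graph.irreflexive G u) a

dist-refl : ∀ {n} (G : Graph n) u → dist G u u ≡ [ 0 ]
dist-refl G u = distance-unique G [ 0 ] (refl , λ _ _ → z≤n)

dist-0⇒≡ : ∀ {n} (G : Graph n) {u v} → dist G u v ≡ [ 0 ] → u ≡ v
dist-0⇒≡ G {u} {v} eq = proj₁ (subst (IsDistance G u v) eq (proj₂ (distance G u v)))

dist-adj : ∀ {n} (G : Graph n) {u v} → Adj G u v → dist G u v ≡ [ 1 ]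
dist-adj G {u} {v} a = distance-unique G [ 1 ] ((v , a , refl) , minimal)
  where
  minimal : ∀ j → Walk G u v j → 1 ≤ j
  minimal zero    refl = contradiction a (adj-irrefl G)
  minimal (suc j) _    = s≤s z≤n

dist-1⇒adj : ∀ {n} (G : Graph n) {u v} → dist G u v ≡ [ 1 ] → Adj G u v
dist-1⇒adj G {u} {v} eq with subst (IsDistance G u v) eq (proj₂ (distance G u v))
... | (_ , a , refl) , _ = a

dist-common-neighbour : ∀ {n} (G : Graph n) {u v} x → u ≢ v → ¬ Adj G u v →
                        Adj G u x → Adj G x v → dist G u v ≡ [ 2 ]
dist-common-neighbour G {u} {v} x u≢v ¬a a b =
  distance-unique G [ 2 ] ((x , a , v , b , refl) , minimal)
  where
  minimal : ∀ j → Walk G u v j → 2 ≤ j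
  minimal zero          p              = contradiction p u≢v
  minimal (suc zero)    (_ , a′ , refl) = contradiction a′ ¬a
  minimal (suc (suc j)) _              = s≤s (s≤s z≤n)

self-resolves : ∀ {n} (G : Graph n) {u v} → u ≢ v → Resolves G u u v
self-resolves G u≢v eq = u≢v (sym (dist-0⇒≡ G (trans (sym eq) (dist-refl G _))))

adj-resolves : ∀ {n} (G : Graph n) {w u v} → Adj G u w → ¬ Adj G v w → Resolves G w u v
adj-resolves G a ¬a eq = ¬a (dist-1⇒adj G (trans (sym eq) (dist-adj G a)))

resolves-sym : ∀ {n} (G : Graph n) {w u v} → Resolves G w u v → Resolves G w v u
resolves-sym G r = r ∘ sym

-- Graphs from decidable relations

T-does⁺ : ∀ {A : Set} (a? : Dec A) → A → T (does a?)
T-does⁺ (yes _) _ = _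
T-does⁺ (no ¬a) a = ¬a a

T-does⁻ : ∀ {A : Set} (a? : Dec A) → T (does a?) → A
T-does⁻ (yes a) _ = a

graph : ∀ {n} → NonZero n → {E : Fin n → Fin n → Set} → (∀ u v → Dec (E u v)) →
        (∀ {u v} → E u v → E v u) → (∀ u → ¬ E u u) → Graph n
graph n≢0 E? E-sym E-irrefl = record
  { nonEmpty    = n≢0
  ; adj         = λ u v → does (E? u v)
  ; symmetric   = λ u v → does-⇔ (mk⇔ E-sym E-sym) (E? u v) (E? v u)
  ; irreflexive = λ u → dec-false (E? u u) (E-irrefl u)
  }

-- Sums over colours and fibres of a colouring

∑ : ∀ {k} → (Fin k → ℕ) → ℕ
∑ g = sum (tabulate g)

length-concat-tabulate : ∀ {A : Set} {k} (xss : Fin k → List A) →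
                         length (concat (tabulate xss)) ≡ ∑ (length ∘ xss)
length-concat-tabulate {k = zero}  xss = refl
length-concat-tabulate {k = suc k} xss =
  trans (length-++ (xss zero)) (cong (λ m → length (xss zero) + m) (length-concat-tabulate (xss ∘ suc)))

∑-zero : ∀ k → ∑ {k} (λ _ → 0) ≡ 0
∑-zero zero    = refl
∑-zero (suc k) = ∑-zero k

∑-cong : ∀ {k} {g h : Fin k → ℕ} → (∀ i → g i ≡ h i) → ∑ g ≡ ∑ h
∑-cong {zero}  g≗h = refl
∑-cong {suc k} g≗h = cong₂ _+_ (g≗h zero) (∑-cong (g≗h ∘ suc))

-- Meant for prepending an element of colour `a` to a list: `h` and `g` are the fibre sizes before
-- and after, and only one fibre grows.
∑-suc-at : ∀ {k} {g h : Fin k → ℕ} a → g a ≡ suc (h a) → (∀ i → a ≢ i → g i ≡ h i) →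
           ∑ g ≡ suc (∑ h)
∑-suc-at zero    at off = cong₂ _+_ at (∑-cong λ i → off (suc i) λ ())
∑-suc-at {h = h} (suc a) at off =
  trans (cong₂ _+_ (off zero λ ())
                   (∑-suc-at a at λ i a≢i → off (suc i) (a≢i ∘ Fin.suc-injective)))
        (+-suc (h zero) _)

∑-≥ : ∀ {k} {g : Fin k → ℕ} b → (∀ i → b ≤ g i) → k * b ≤ ∑ g
∑-≥ {zero}  b b≤g = z≤n
∑-≥ {suc k} b b≤g = +-mono-≤ (b≤g zero) (∑-≥ b (b≤g ∘ suc))

fibre : ∀ {A : Set} {k} → (A → Fin k) → List A → Fin k → List A
fibre c xs i = filter (λ x → c x Fin.≟ i) xs

∑-length-fibre : ∀ {A : Set} {k} (c : A → Fin k) xs → ∑ (length ∘ fibre c xs) ≡ length xs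
∑-length-fibre {k = k} c [] = ∑-zero k
∑-length-fibre c (x ∷ xs) = trans
  (∑-suc-at (c x) (cong length (filter-accept (λ y → c y Fin.≟ c x) refl))
                  (λ i cx≢i → cong length (filter-reject (λ y → c y Fin.≟ i) cx≢i)))
  (cong suc (∑-length-fibre c xs))

lookup-injective : ∀ {A : Set} {xs : List A} → Unique xs →
                   ∀ i j → lookup xs i ≡ lookup xs j → i ≡ j
lookup-injective (x∉ AllPairs.∷ u) zero    zero    eq = refl
lookup-injective (x∉ AllPairs.∷ u) zero    (suc j) eq = contradiction eq (All.lookup x∉ (∈-lookup j))
lookup-injective (x∉ AllPairs.∷ u) (suc i) zero    eq = contradiction (sym eq) (All.lookup x∉ (∈-lookup i))
lookup-injective (x∉ AllPairs.∷ u) (suc i) (suc j) eq = cong suc (lookup-injective u i j eq)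

-- Subsets of vertices and lists

fromList : ∀ {n} → List (Fin n) → Subset n
fromList []       = ⊥
fromList (x ∷ xs) = ⁅ x ⁆ ∪ fromList xs

∈-fromList : ∀ {n} {x : Fin n} {xs} → x ∈ xs → x ∈ˢ fromList xs
∈-fromList {x = x} (Any.here refl) = x∈p∪q⁺ (inj₁ (x∈⁅x⁆ x))
∈-fromList (Any.there p)           = x∈p∪q⁺ (inj₂ (∈-fromList p))

∣p∪q∣≤∣p∣+∣q∣ : ∀ {n} (p q : Subset n) → ∣ p ∪ q ∣ ≤ ∣ p ∣ + ∣ q ∣
∣p∪q∣≤∣p∣+∣q∣ []            []            = z≤n
∣p∪q∣≤∣p∣+∣q∣ (inside ∷ p)  (inside ∷ q)  =
  s≤s (≤-trans (∣p∪q∣≤∣p∣+∣q∣ p q) (+-monoʳ-≤ ∣ p ∣ (n≤1+n ∣ q ∣)))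
∣p∪q∣≤∣p∣+∣q∣ (inside ∷ p)  (outside ∷ q) = s≤s (∣p∪q∣≤∣p∣+∣q∣ p q)
∣p∪q∣≤∣p∣+∣q∣ (outside ∷ p) (inside ∷ q)  =
  ≤-trans (s≤s (∣p∪q∣≤∣p∣+∣q∣ p q)) (≤-reflexive (sym (+-suc ∣ p ∣ ∣ q ∣)))
∣p∪q∣≤∣p∣+∣q∣ (outside ∷ p) (outside ∷ q) = ∣p∪q∣≤∣p∣+∣q∣ p q

-- Repeated entries collapse in the union. An upper bound on `β` takes just this direction.
∣fromList∣≤length : ∀ {n} (xs : List (Fin n)) → ∣ fromList xs ∣ ≤ length xs
∣fromList∣≤length {n} []   = ≤-reflexive (∣⊥∣≡0 n)
∣fromList∣≤length (x ∷ xs) = ≤-trans (∣p∪q∣≤∣p∣+∣q∣ ⁅ x ⁆ (fromList xs))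
  (+-mono-≤ (≤-reflexive (∣⁅x⁆∣≡1 x)) (∣fromList∣≤length xs))

elements : ∀ {n} → Subset n → List (Fin n)
elements []            = []
elements (inside ∷ p)  = zero ∷ map suc (elements p)
elements (outside ∷ p) = map suc (elements p)

length-elements : ∀ {n} (p : Subset n) → length (elements p) ≡ ∣ p ∣
length-elements []            = refl
length-elements (inside ∷ p)  = cong suc (trans (length-map suc (elements p)) (length-elements p))
length-elements (outside ∷ p) = trans (length-map suc (elements p)) (length-elements p)

∈-elements : ∀ {n} {x : Fin n} {p} → x ∈ˢ p → x ∈ elements p
∈-elements {p = inside ∷ p}  here        = Any.here refl
∈-elements {p = inside ∷ p}  (there x∈p) = Any.there (∈-map⁺ suc (∈-elements x∈p))
∈-elements {p = outside ∷ p} (there x∈p) = ∈-map⁺ suc (∈-elements x∈p)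

-- Binary digits, least significant first

bit : ℕ → ℕ → ℕ
bit s zero    = s mod 2
bit s (suc j) = bit (s ÷ 2) j

bit-zero : ∀ j → bit 0 j ≡ 0
bit-zero zero    = refl
bit-zero (suc j) = bit-zero j

bit≢0⇒≡1 : ∀ s j → bit s j ≢ 0 → bit s j ≡ 1
bit≢0⇒≡1 s (suc j) ≢0 = bit≢0⇒≡1 (s ÷ 2) j ≢0
bit≢0⇒≡1 s zero    ≢0 = ≤-antisym (s≤s⁻¹ (m%n<n s 2)) (n≢0⇒n>0 ≢0)

-- A number is determined by its last digit and its half, so if the last digits agree, the halves
-- differ and the induction continues with them.
bit-distinguishes : ∀ d {s t} → s < 2 ^ d → t < 2 ^ d → s ≢ t →
                    ∃[ j ] (j < d × bit s j ≢ bit t j)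
bit-distinguishes zero    {zero} {zero} _ _ s≢t = contradiction refl s≢t
bit-distinguishes zero    {suc _}       (s≤s ()) _ s≢t
bit-distinguishes zero    {zero} {suc _} _ (s≤s ()) s≢t
bit-distinguishes (suc d) {s} {t} s< t< s≢t with s mod 2 ≟ t mod 2
... | no  ≢  = 0 , z<s , ≢
... | yes eq with bit-distinguishes d (half s<) (half t<) halves≢
  where
  half : ∀ {r} → r < 2 ^ suc d → r ÷ 2 < 2 ^ d
  half {r} r< = m<n*o⇒m/o<n (<-≤-trans r< (≤-reflexive (*-comm 2 (2 ^ d))))

  halves≢ : s ÷ 2 ≢ t ÷ 2
  halves≢ h = s≢t (trans (m≡m%n+[m/n]*n s 2)
                  (trans (cong₂ (λ a b → a + b * 2) eq h) (sym (m≡m%n+[m/n]*n t 2))))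
... | j , j<d , ≢ = suc j , s<s j<d , ≢

bit-nonzero : ∀ d {s} → suc s < 2 ^ d → ∃[ j ] (j < d × bit (suc s) j ≢ 0)
bit-nonzero d s< with bit-distinguishes d s< (m^n>0 2 d) (λ ())
... | j , j<d , ≢ = j , j<d , λ eq → ≢ (trans eq (sym (bit-zero j)))

m<2^m : ∀ m → m < 2 ^ m
m<2^m zero    = z<s
m<2^m (suc m) = +-mono-≤ (m^n>0 2 m) (≤-trans (m<2^m m) (≤-reflexive (sym (+-identityʳ (2 ^ m)))))

-- Thresholds of class sizes and values of `f`

IsThreshold : ℕ → ℕ → Set
IsThreshold m = IsMinimum (λ d → m < 2 ^ d + d)

-- The analogue of `f` for a class size, which is 0 when a colouring misses a colour; then the least
-- d is 0.
threshold : ∀ m → Minimum (λ d → m < 2 ^ d + d)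
threshold m = minimum (λ d → m <? 2 ^ d + d) (m , m<n+m m (m^n>0 2 m))

threshold-≥ : ∀ {m e} → IsThreshold m (suc e) → 2 ^ e + e ≤ m
threshold-≥ (_ , min) = ≮⇒≥ λ m< → 1+n≰n (min _ m<)

-- Ensures that a class has enough vertices to supply its landmarks: for d = e + 1, minimality gives
-- e + 1 ≤ 2 ^ e + e ≤ m.
threshold-≤ : ∀ {m d} → IsThreshold m d → d ≤ m
threshold-≤ {d = zero}  _ = z≤n
threshold-≤ {d = suc e} t = ≤-trans (+-monoˡ-≤ e (m^n>0 2 e)) (threshold-≥ t)

-- Unnormalised rationals bypass the reduction to lowest terms in `_/_`, so that the order is
-- literally cross multiplication.
/-<⇒ : ∀ n k b .{{_ : NonZero k}} → (+ n / k) ℚ.< (+ b / 1) → n < b * k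
/-<⇒ n (suc k) b lt with
  ℚᵘ.<-respˡ-≃ (ℚ.toℚᵘ-fromℚᵘ (ℚᵘ.mkℚᵘ (+ n) k))
    (ℚᵘ.<-respʳ-≃ (ℚ.toℚᵘ-fromℚᵘ (ℚᵘ.mkℚᵘ (+ b) 0)) (ℚ.toℚᵘ-mono-< lt))
... | ℚᵘ.*<* p = ℤ.drop‿+<+ (subst₂ ℤ._<_ (ℤ.*-identityʳ (+ n)) (sym (ℤ.pos-* b (suc k))) p)

/-<⇐ : ∀ n k b .{{_ : NonZero k}} → n < b * k → (+ n / k) ℚ.< (+ b / 1)
/-<⇐ n (suc k) b lt = ℚ.toℚᵘ-cancel-<
  (ℚᵘ.<-respˡ-≃ (ℚᵘ.≃-sym (ℚ.toℚᵘ-fromℚᵘ (ℚᵘ.mkℚᵘ (+ n) k)))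
    (ℚᵘ.<-respʳ-≃ (ℚᵘ.≃-sym (ℚ.toℚᵘ-fromℚᵘ (ℚᵘ.mkℚᵘ (+ b) 0)))
      (ℚᵘ.*<* (subst₂ ℤ._<_ (sym (ℤ.*-identityʳ (+ n))) (ℤ.pos-* b (suc k)) (ℤ.+<+ lt)))))

f-upper : ∀ n k .{{_ : NonZero k}} → let d = f (+ n / k) in n < (2 ^ d + d) * k
f-upper n k = bound (f-minimum (+ n / k))
  where
  bound : (m : Minimum λ d → + n / k ℚ.< + (2 ^ d + d) / 1) → n < (2 ^ proj₁ m + proj₁ m) * k
  bound (d , lt , _) = /-<⇒ n k (2 ^ d + d) lt

f-least : ∀ n k .{{_ : NonZero k}} d → n < (2 ^ d + d) * k → f (+ n / k) ≤ d
f-least n k d lt = least (f-minimum (+ n / k))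
  where
  least : (m : Minimum λ d → + n / k ℚ.< + (2 ^ d + d) / 1) → proj₁ m ≤ d
  least (_ , _ , minimal) = minimal d (/-<⇐ n k (2 ^ d + d) lt)

-- The supergraph for the upper bound and its landmarks

module Completion {n k : ℕ} (n≢0 : NonZero n) (c : Fin n → Fin k) where

  class : Fin k → List (Fin n)
  class = fibre c (allFin n)

  ∈-class : ∀ u → u ∈ class (c u)
  ∈-class u = ∈-filter⁺ (λ v → c v Fin.≟ c u) (∈-allFin u) refl

  colour-lookup : ∀ i j → c (lookup (class i) j) ≡ i
  colour-lookup i j = proj₂ (∈-filter⁻ (λ v → c v Fin.≟ i) {xs = allFin n} (∈-lookup j))

  class-unique : ∀ i → Unique (class i)
  class-unique i = Unique.filter⁺ (λ v → c v Fin.≟ i) (Unique.allFin⁺ n)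

  -- Ranks below `d i` will belong to the landmarks of class `i`; the higher ranks yield the codes
  -- of its other vertices.
  rank : Fin n → ℕ
  rank u = toℕ (index (∈-class u))

  rank-injective : ∀ {u v} → c u ≡ c v → rank u ≡ rank v → u ≡ v
  rank-injective {u} {v} = go (∈-class u) (∈-class v)
    where
    -- The two membership proofs concern different lists until the colours, made variables here, are
    -- identified by matching.
    go : ∀ {i j} (p : u ∈ class i) (q : v ∈ class j) → i ≡ j →
         toℕ (index p) ≡ toℕ (index q) → u ≡ v
    go {i} p q refl eq = trans (lookup-index p)
      (trans (cong (lookup (class i)) (Fin.toℕ-injective eq)) (sym (lookup-index q)))

  -- `∈-class` finds some position of the vertex; since a class has no repeated entries, that
  -- position is `j`.
  rank-lookup : ∀ i j → rank (lookup (class i) j) ≡ toℕ j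
  rank-lookup i j = go (∈-class _) (colour-lookup i j)
    where
    go : ∀ {i′} (p : lookup (class i) j ∈ class i′) → i′ ≡ i → toℕ (index p) ≡ toℕ j
    go p refl = cong toℕ (lookup-injective (class-unique i) (index p) j (sym (lookup-index p)))

  rank< : ∀ {i} u → c u ≡ i → rank u < length (class i)
  rank< u refl = Fin.toℕ<n (index (∈-class u))

  d : Fin k → ℕ
  d i = proj₁ (threshold (length (class i)))

  d-threshold : ∀ i → IsThreshold (length (class i)) (d i)
  d-threshold i = proj₂ (threshold (length (class i)))

  landmark : ∀ i → Fin (d i) → Fin n
  landmark i j = lookup (class i) (Fin.inject≤ j (threshold-≤ (d-threshold i)))

  rank-landmark : ∀ i j → rank (landmark i j) ≡ toℕ j
  rank-landmark i j = trans (rank-lookup i _) (Fin.toℕ-inject≤ j _)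

  landmarks : List (Fin n)
  landmarks = concat (tabulate λ i → tabulate (landmark i))

  length-landmarks : length landmarks ≡ ∑ d
  length-landmarks = trans (length-concat-tabulate (λ i → tabulate (landmark i)))
                           (∑-cong λ i → length-tabulate (landmark i))

  landmark∈ : ∀ i j → landmark i j ∈ˢ fromList landmarks
  landmark∈ i j = ∈-fromList (∈-concat⁺′ (∈-tabulate⁺ j) (∈-tabulate⁺ i))

  landmark-of-rank : ∀ i {j} → j < d i →
                     ∃[ w ] (w ∈ˢ fromList landmarks × c w ≡ i × rank w ≡ j)
  landmark-of-rank i j<d =
    landmark i (fromℕ< j<d) , landmark∈ i _ , colour-lookup i _ ,
    trans (rank-landmark i _) (Fin.toℕ-fromℕ< j<d)

  low-rank⇒landmark : ∀ {u} → rank u < d (c u) → u ∈ˢ fromList landmarks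
  low-rank⇒landmark {u} r<d with w , w∈ , cw , rw ← landmark-of-rank (c u) r<d =
    subst (_∈ˢ fromList landmarks) (rank-injective cw rw) w∈

  -- Codes start at 1: a vertex with code 0 would be adjacent to every landmark
  -- of its class, hence not separated from the other classes.
  code : Fin k → Fin n → ℕ
  code i u = suc (rank u ∸ d i)

  -- With m the class size, `suc (rank u)` ≤ m < 2 ^ d + d. So the choice of d leaves room for codes
  -- of d digits even though they start at 1.
  code< : ∀ {i u} → c u ≡ i → d i ≤ rank u → code i u < 2 ^ d i
  code< {i} {u} cu d≤r = subst (_< 2 ^ d i) (+-∸-assoc 1 d≤r)
    (m<n+o⇒m∸n<o (suc (rank u)) (d i) {{m^n≢0 2 (d i)}} (≤-<-trans (rank< u cu)
      (<-≤-trans (proj₁ (d-threshold i)) (≤-reflexive (+-comm (2 ^ d i) (d i))))))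

  -- Digit 0 stands for adjacency, so that a nonzero digit marks a landmark of the own class that is
  -- not a neighbour. Pairs of different colours are joined by `Edge` in any case.
  Attached : Fin n → Fin n → Set
  Attached u w = d (c u) ≤ rank u × rank w < d (c u) × bit (code (c u) u) (rank w) ≡ 0

  Edge : Fin n → Fin n → Set
  Edge u v = c u ≢ c v ⊎ (Attached u v ⊎ Attached v u)

  attached? : ∀ u w → Dec (Attached u w)
  attached? u w = (d (c u) ≤? rank u) ×-dec
                  ((rank w <? d (c u)) ×-dec (bit (code (c u) u) (rank w) ≟ 0))

  edge? : ∀ u v → Dec (Edge u v)
  edge? u v = ¬? (c u Fin.≟ c v) ⊎-dec (attached? u v ⊎-dec attached? v u)

  edge-irrefl : ∀ u → ¬ Edge u u
  edge-irrefl u (inj₁ ≢)                        = ≢ refl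
  edge-irrefl u (inj₂ (inj₁ (d≤r , r<d , _))) = <⇒≱ r<d d≤r
  edge-irrefl u (inj₂ (inj₂ (d≤r , r<d , _))) = <⇒≱ r<d d≤r

  edge-sym : ∀ {u v} → Edge u v → Edge v u
  edge-sym (inj₁ ≢) = inj₁ (≢ ∘ sym)
  edge-sym (inj₂ a) = inj₂ (swap a)

  completion : Graph n
  completion = graph n≢0 edge? edge-sym edge-irrefl

  edge⇒adj : ∀ {u v} → Edge u v → Adj completion u v
  edge⇒adj {u} {v} = T-does⁺ (edge? u v)

  module _ {i u w} (cu : c u ≡ i) (cw : c w ≡ i) (d≤r : d i ≤ rank u) (r<d : rank w < d i) where

    adj-landmark⁺ : bit (code i u) (rank w) ≡ 0 → Adj completion u w
    adj-landmark⁺ b = edge⇒adj (inj₂ (inj₁ (subst Attached-at (sym cu) (d≤r , r<d , b))))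
      where
      Attached-at : Fin k → Set
      Attached-at i = d i ≤ rank u × rank w < d i × bit (code i u) (rank w) ≡ 0

    -- Of the three sources of an edge, equal colours exclude the first, and the low rank of `w`
    -- excludes that `w` is attached to `u`.
    adj-landmark⁻ : Adj completion u w → bit (code i u) (rank w) ≡ 0
    adj-landmark⁻ a with T-does⁻ (edge? u w) a
    ... | inj₁ ≢                     = contradiction (trans cu (sym cw)) ≢
    ... | inj₂ (inj₁ (_ , _ , b))    = subst (λ i′ → bit (code i′ u) (rank w) ≡ 0) cu b
    ... | inj₂ (inj₂ (d≤rw , _ , _)) =
      contradiction (subst (λ i′ → d i′ ≤ rank w) cw d≤rw) (<⇒≱ r<d)

  Resolved : Fin n → Fin n → Set
  Resolved u v = ∃[ w ] (w ∈ˢ fromList landmarks × Resolves completion w u v)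

  resolved-sym : ∀ {u v} → Resolved u v → Resolved v u
  resolved-sym (w , w∈ , r) = w , w∈ , resolves-sym completion r

  resolved-by-landmark : ∀ {u v} → u ≢ v → rank u < d (c u) → Resolved u v
  resolved-by-landmark {u} u≢v r<d = u , low-rank⇒landmark r<d , self-resolves completion u≢v

  -- A nonzero digit in the code of `u` gives a landmark of its class not adjacent to `u`; `v` is
  -- adjacent to it, having another colour.
  resolved-across : ∀ {u v} → c u ≢ c v → d (c u) ≤ rank u → Resolved u v
  resolved-across {u} {v} cu≢cv d≤r =
    let j , j<d , b≢0    = bit-nonzero (d (c u)) {rank u ∸ d (c u)} (code< refl d≤r)
        w , w∈ , cw , rw = landmark-of-rank (c u) j<d
        adj-vw           = edge⇒adj (inj₁ λ eq → cu≢cv (sym (trans eq cw)))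
        ¬adj-uw a        = b≢0 (subst (λ j → bit (code (c u) u) j ≡ 0) rw
                             (adj-landmark⁻ refl cw d≤r (subst (_< d (c u)) (sym rw) j<d) a))
    in w , w∈ , resolves-sym completion (adj-resolves completion adj-vw ¬adj-uw)

  -- Different ranks from `d i` upwards give different codes. A digit where they differ is 0 in
  -- exactly one of them, so its landmark is adjacent to exactly one of the two vertices.
  resolved-within : ∀ {u v} i → c u ≡ i → c v ≡ i → u ≢ v → d i ≤ rank u → d i ≤ rank v → Resolved u v
  resolved-within {u} {v} i cu cv u≢v d≤u d≤v =
    let j , j<d , b≢b    = bit-distinguishes (d i) {code i u} {code i v} (code< cu d≤u) (code< cv d≤v) codes≢
        w , w∈ , cw , rw = landmark-of-rank i j<d
    in resolve w w∈ cw (subst (_< d i) (sym rw) j<d)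
         (subst (λ j → bit (code i u) j ≢ bit (code i v) j) (sym rw) b≢b)
         (bit (code i u) (rank w) ≟ 0) (bit (code i v) (rank w) ≟ 0)
    where
    codes≢ : code i u ≢ code i v
    codes≢ eq = u≢v (rank-injective (trans cu (sym cv)) (∸-cancelʳ-≡ d≤u d≤v (suc-injective eq)))

    resolve : ∀ w → w ∈ˢ fromList landmarks → c w ≡ i → rank w < d i →
              bit (code i u) (rank w) ≢ bit (code i v) (rank w) →
              Dec (bit (code i u) (rank w) ≡ 0) → Dec (bit (code i v) (rank w) ≡ 0) → Resolved u v
    resolve w w∈ cw r<d b≢b (yes bu) (yes bv) = contradiction (trans bu (sym bv)) b≢b
    resolve w w∈ cw r<d b≢b (no ¬bu) (no ¬bv) = contradiction
      (trans (bit≢0⇒≡1 (code i u) (rank w) ¬bu) (sym (bit≢0⇒≡1 (code i v) (rank w) ¬bv))) b≢b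
    resolve w w∈ cw r<d b≢b (yes bu) (no ¬bv) = w , w∈ , adj-resolves completion
      (adj-landmark⁺ cu cw d≤u r<d bu) (¬bv ∘ adj-landmark⁻ cv cw d≤v r<d)
    resolve w w∈ cw r<d b≢b (no ¬bu) (yes bv) = w , w∈ , resolves-sym completion
      (adj-resolves completion (adj-landmark⁺ cv cw d≤v r<d bv) (¬bu ∘ adj-landmark⁻ cu cw d≤u r<d))

  landmarks-resolving : Resolving completion (fromList landmarks)
  landmarks-resolving u v u≢v = resolve (rank u <? d (c u)) (rank v <? d (c v)) (c u Fin.≟ c v)
    where
    resolve : Dec (rank u < d (c u)) → Dec (rank v < d (c v)) → Dec (c u ≡ c v) → Resolved u v
    resolve (yes r<d) _         _           = resolved-by-landmark u≢v r<d
    resolve (no _)    (yes r<d) _           = resolved-sym (resolved-by-landmark (u≢v ∘ sym) r<d)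
    resolve (no r≮d)  (no _)    (no cu≢cv)  = resolved-across cu≢cv (≮⇒≥ r≮d)
    resolve (no r≮d)  (no r≮d′) (yes cu≡cv) = resolved-within (c v) cu≡cv refl u≢v
      (subst (λ i → d i ≤ rank u) cu≡cv (≮⇒≥ r≮d)) (≮⇒≥ r≮d′)

  β-completion : β completion ≤ ∑ d
  β-completion = ≤-trans
    (proj₂ (proj₂ (β-minimum completion)) _ (fromList landmarks , landmarks-resolving , refl))
    (≤-trans (∣fromList∣≤length landmarks) (≤-reflexive length-landmarks))

  ∑-class : ∑ (length ∘ class) ≡ n
  ∑-class = trans (∑-length-fibre c (allFin n)) (length-tabulate id)

-- Convexity and the upper bound

τ-≤ : ∀ {n} {G : Graph n} H → G ⊆ᴳ H → τ G ≤ β H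
τ-≤ {G = G} H G⊆H = proj₂ (proj₂ (τ-minimum G)) _ (H , G⊆H , refl)

-- 2 ^ e lies above the line of slope 2 ^ D through (D , 2 ^ D).
2^-tangent : ∀ D e → suc e * 2 ^ D ≤ 2 ^ e + D * 2 ^ D
2^-tangent D e with e <? D
... | yes e<D = ≤-trans (*-monoˡ-≤ (2 ^ D) e<D) (m≤n+m _ (2 ^ e))
... | no e≮D  = subst (λ e → suc e * 2 ^ D ≤ 2 ^ e + D * 2 ^ D) (m+[n∸m]≡n (≮⇒≥ e≮D)) (above (e ∸ D))
  where
  open ≤-Reasoning
  above : ∀ j → suc (D + j) * 2 ^ D ≤ 2 ^ (D + j) + D * 2 ^ D
  above j = begin
    suc (D + j) * 2 ^ D         ≡⟨ +-*-Solver.solve 3 (λ D j p → (con 1 :+ (D :+ j)) :* p :=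
                                      (con 1 :+ j) :* p :+ D :* p) refl D j (2 ^ D) ⟩
    suc j * 2 ^ D + D * 2 ^ D   ≤⟨ +-monoˡ-≤ (D * 2 ^ D) (*-monoˡ-≤ (2 ^ D) (m<2^m j)) ⟩
    2 ^ j * 2 ^ D + D * 2 ^ D   ≡⟨ cong (_+ D * 2 ^ D) (trans (sym (^-distribˡ-+-* 2 j D))
                                                         (cong (2 ^_) (+-comm j D))) ⟩
    2 ^ (D + j) + D * 2 ^ D     ∎
    where open +-*-Solver using (con; _:+_; _:*_; _:=_)

-- For d = e + 1 the size m is at least 2 ^ e + e, and this lies above the tangent-like line of
-- slope 2 ^ D + 1 through (D, 2 ^ D + D). Terms are moved across so that no truncated subtraction
-- occurs.
threshold-tangent : ∀ {m d} D → IsThreshold m d →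
                    d * suc (2 ^ D) + (2 ^ D + D) ≤ m + suc D * suc (2 ^ D)
-- Here d has no predecessor; (D + 1)(2 ^ D + 1) alone dominates 2 ^ D + D.
threshold-tangent {m} {zero} D _ =
  ≤-trans (+-mono-≤ (n≤1+n (2 ^ D)) (m≤m*n D (suc (2 ^ D)))) (m≤n+m _ m)
threshold-tangent {m} {suc e} D t = begin
  suc e * suc P + (P + D)           ≡⟨ solve 3 (λ e P D → (con 1 :+ e) :* (con 1 :+ P) :+ (P :+ D) :=
                                                  (con 1 :+ e) :* P :+ (con 1 :+ e :+ P :+ D)) refl e P D ⟩
  suc e * P + (1 + e + P + D)       ≤⟨ +-monoˡ-≤ _ (2^-tangent D e) ⟩
  2 ^ e + D * P + (1 + e + P + D)   ≡⟨ solve 4 (λ x e P D → x :+ D :* P :+ (con 1 :+ e :+ P :+ D) :=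
                                                  (x :+ e) :+ (con 1 :+ D) :* (con 1 :+ P)) refl (2 ^ e) e P D ⟩
  2 ^ e + e + suc D * suc P         ≤⟨ +-monoˡ-≤ _ (threshold-≥ t) ⟩
  m + suc D * suc P                 ∎
  where
  open ≤-Reasoning
  open +-*-Solver using (solve; con; _:+_; _:*_; _:=_)
  P : ℕ
  P = 2 ^ D

∑-linear : ∀ {k} {g h : Fin k → ℕ} a b b′ → (∀ i → g i * a + b ≤ h i + b′) →
           ∑ g * a + k * b ≤ ∑ h + k * b′
∑-linear {zero}          a b b′ le = z≤n
∑-linear {suc k} {g} {h} a b b′ le = begin
  (g zero + G) * a + (b + k * b)      ≡⟨ solve 5 (λ x G a b B → (x :+ G) :* a :+ (b :+ B) :=
                                                    (x :* a :+ b) :+ (G :* a :+ B)) refl (g zero) G a b (k * b) ⟩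
  (g zero * a + b) + (G * a + k * b)  ≤⟨ +-mono-≤ (le zero) (∑-linear a b b′ (le ∘ suc)) ⟩
  (h zero + b′) + (H + k * b′)        ≡⟨ solve 4 (λ y b H B → (y :+ b) :+ (H :+ B) :=
                                                    (y :+ H) :+ (b :+ B)) refl (h zero) b′ H (k * b′) ⟩
  (h zero + H) + (b′ + k * b′)        ∎
  where
  open ≤-Reasoning
  open +-*-Solver using (solve; con; _:+_; _:*_; _:=_)
  G H : ℕ
  G = ∑ (g ∘ suc)
  H = ∑ (h ∘ suc)

-- The tangent inequalities are linear, so they add up over the classes and see only the total
-- `∑ m`. Strictness survives cancelling k (2 ^ D + D) and the factor 2 ^ D + 1.
∑-threshold : ∀ {k} {m d : Fin k → ℕ} D → (∀ i → IsThreshold (m i) (d i)) →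
              ∑ m < (2 ^ D + D) * k → ∑ d < k * suc D
∑-threshold {k} {m} {d} D t lt =
  *-cancelʳ-< (suc P) _ _ (+-cancelʳ-< (k * (P + D)) _ _ (begin-strict
    ∑ d * suc P + k * (P + D)           ≤⟨ ∑-linear (suc P) (P + D) (suc D * suc P)
                                                    (λ i → threshold-tangent D (t i)) ⟩
    ∑ m + k * (suc D * suc P)           <⟨ +-monoˡ-< _ lt ⟩
    (P + D) * k + k * (suc D * suc P)   ≡⟨ solve 3 (λ P D k → (P :+ D) :* k :+
                                              k :* ((con 1 :+ D) :* (con 1 :+ P)) :=
                                              k :* (con 1 :+ D) :* (con 1 :+ P) :+ k :* (P :+ D)) refl P D k ⟩
    k * suc D * suc P + k * (P + D)     ∎))
  where
  open ≤-Reasoning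
  open +-*-Solver using (solve; con; _:+_; _:*_; _:=_)
  P : ℕ
  P = 2 ^ D

τ-upper : ∀ n k .{{_ : NonZero k}} (G : Graph n) → χ G ≡ k → τ G ≤ k * (f (+ n / k) + 1) ∸ 1
τ-upper n k G refl = begin
  τ G                          ≤⟨ τ-≤ {G = G} completion G⊆completion ⟩
  β completion                 ≤⟨ β-completion ⟩
  -- The strict inequality is `suc (∑ d) ≤ k * suc D`; lowering both sides by 1 produces the final
  -- `∸ 1`.
  ∑ d                          ≤⟨ ∸-monoˡ-≤ 1 (∑-threshold D d-threshold
                                    (subst (_< (2 ^ D + D) * k) (sym ∑-class) (f-upper n k))) ⟩
  k * suc D ∸ 1                ≡⟨ cong (λ x → k * x ∸ 1) (+-comm 1 D) ⟩
  k * (D + 1) ∸ 1              ∎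
  where
  open ≤-Reasoning
  D : ℕ
  D = f (+ n / k)
  colouring : Colourable G k
  colouring = proj₁ (proj₂ (χ-minimum G))
  open Completion (Graph.nonEmpty G) (proj₁ colouring)
  G⊆completion : G ⊆ᴳ completion
  G⊆completion u v a = edge⇒adj (inj₁ (proj₂ colouring u v a))

-- Class sizes against landmarks when all different colours are joined

toBit : Bool → Fin 2
toBit false = zero
toBit true  = suc zero

toBit-injective : ∀ {a b} → toBit a ≡ toBit b → a ≡ b
toBit-injective {false} {false} _ = refl
toBit-injective {true}  {true}  _ = refl

module _ {n k : ℕ} (H : Graph n) (c : Fin n → Fin k)
         (joined : ∀ {u v} → c u ≢ c v → Adj H u v) where

  module _ (W : Subset n) (resolving : Resolving H W)
           (i : Fin k) (x : Fin n) (cx≢i : c x ≢ i) where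

    private
      L : List (Fin n)
      L = fibre c (elements W) i

    ∈L? : ∀ u → Dec (u ∈ L)
    ∈L? u = DecMembership._∈?_ Fin._≟_ u L

    -- A landmark of another colour is at distance 1 from both vertices. For one of colour `i`,
    -- distance 1 means adjacency and every other distance is 2, through `x`.
    unresolved : ∀ {u v} → c u ≡ i → c v ≡ i → ¬ u ∈ L → ¬ v ∈ L →
                 (∀ j → adj H u (lookup L j) ≡ adj H v (lookup L j)) →
                 ∀ w → w ∈ˢ W → dist H u w ≡ dist H v w
    unresolved {u} {v} cu cv u∉L v∉L same w w∈W with c w Fin.≟ i
    ... | no cw≢i = trans (dist-adj H (joined λ eq → cw≢i (trans (sym eq) cu)))
                          (sym (dist-adj H (joined λ eq → cw≢i (trans (sym eq) cv))))
    ... | yes cw≡i = go (T? (adj H u w))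
      where
      w∈L : w ∈ L
      w∈L = ∈-filter⁺ (λ y → c y Fin.≟ i) (∈-elements w∈W) cw≡i

      same-w : adj H u w ≡ adj H v w
      same-w = subst (λ y → adj H u y ≡ adj H v y) (sym (lookup-index w∈L)) (same (index w∈L))

      dist≡2 : ∀ {y} → c y ≡ i → ¬ y ∈ L → ¬ Adj H y w → dist H y w ≡ [ 2 ]
      dist≡2 cy y∉L ¬a = dist-common-neighbour H x (λ { refl → y∉L w∈L }) ¬a
        (joined λ eq → cx≢i (trans (sym eq) cy)) (joined λ eq → cx≢i (trans eq cw≡i))

      go : Dec (Adj H u w) → dist H u w ≡ dist H v w
      go (yes a) = trans (dist-adj H a) (sym (dist-adj H (subst T same-w a)))
      go (no ¬a) = trans (dist≡2 cu u∉L ¬a) (sym (dist≡2 cv v∉L (¬a ∘ subst T (sym same-w))))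

    -- The target has as many elements as the bound in `class-size-≤`. The decision is an argument
    -- so that `place-injective` can match on it.
    place : ∀ u → Dec (u ∈ L) → Fin (length L) ⊎ Fin (2 ^ length L)
    place u (yes p) = inj₁ (index p)
    place u (no _)  = inj₂ (funToFin λ j → toBit (adj H u (lookup L j)))

    -- Two vertices outside `L` with one adjacency pattern would contradict `resolving`, which
    -- starts from `u ≢ v`; hence the doubly negated conclusion.
    place-injective : ∀ {u v} → c u ≡ i → c v ≡ i → (p : Dec (u ∈ L)) (q : Dec (v ∈ L)) →
                      place u p ≡ place v q → ¬ u ≢ v
    place-injective cu cv (yes p) (yes q) eq u≢v = u≢v (trans (lookup-index p)
      (trans (cong (lookup L) (inj₁-injective eq)) (sym (lookup-index q))))
    place-injective {u} {v} cu cv (no u∉L) (no v∉L) eq u≢v =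
      let w , w∈W , r = resolving u v u≢v in r (unresolved cu cv u∉L v∉L same w w∈W)
      where
      same : ∀ j → adj H u (lookup L j) ≡ adj H v (lookup L j)
      same j = toBit-injective (trans (sym (Fin.finToFun-funToFin _ j))
        (trans (cong (λ z → finToFun z j) (inj₂-injective eq)) (Fin.finToFun-funToFin _ j)))

    -- By the pigeonhole principle a larger m would put two vertices in the same place.
    class-size-≤ : ∀ {m} (e : Fin m → Fin n) → (∀ {y z} → e y ≡ e z → y ≡ z) →
                   (∀ y → c (e y) ≡ i) → m ≤ length L + 2 ^ length L
    class-size-≤ {m} e e-injective ce = ≮⇒≥ λ lt →
      let y , z , y<z , eq = Fin.pigeonhole lt (λ y → join (length L) (2 ^ length L) (place′ y))
      in place-injective (ce y) (ce z) (∈L? (e y)) (∈L? (e z))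
           (trans (sym (Fin.splitAt-join _ _ (place′ y)))
             (trans (cong (splitAt (length L)) eq) (Fin.splitAt-join _ _ (place′ z))))
           (λ ey≡ez → Fin.<⇒≢ y<z (e-injective ey≡ez))
      where
      place′ : Fin m → Fin (length L) ⊎ Fin (2 ^ length L)
      place′ y = place (e y) (∈L? (e y))

-- Complete multipartite graphs and their chromatic number

module CompleteMultipartite {n k : ℕ} (n≢0 : NonZero n) (c : Fin n → Fin k) where

  multipartite : Graph n
  multipartite = graph n≢0 (λ u v → ¬? (c u Fin.≟ c v)) (_∘ sym) (λ u u≢u → u≢u refl)

  multipartite-adj : ∀ {u v} → c u ≢ c v → Adj multipartite u v
  multipartite-adj {u} {v} = T-does⁺ (¬? (c u Fin.≟ c v))

  -- Representatives of the k classes form a clique, on which fewer than k colours would repeat.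
  multipartite-χ : (∀ i → ∃[ u ] c u ≡ i) → χ multipartite ≡ k
  multipartite-χ onto = isMinimum-unique id id (proj₂ (χ-minimum multipartite))
    ((c , λ u v → T-does⁻ (¬? (c u Fin.≟ c v))) , minimal)
    where
    rep : Fin k → Fin n
    rep i = proj₁ (onto i)

    minimal : ∀ j → Colourable multipartite j → k ≤ j
    minimal j (col , proper) = ≮⇒≥ λ j<k →
      let i , i′ , i<i′ , eq = Fin.pigeonhole j<k (col ∘ rep)
      in proper (rep i) (rep i′) (multipartite-adj λ ceq → Fin.<⇒≢ i<i′
           (trans (sym (proj₂ (onto i))) (trans ceq (proj₂ (onto i′))))) eq

≤-τ : ∀ {n} {G : Graph n} {m} → (∀ H → G ⊆ᴳ H → ∀ W → Resolving H W → m ≤ ∣ W ∣) → m ≤ τ G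
≤-τ {G = G} bound with τ-minimum G
... | _ , (H , G⊆H , refl) , _ with β-minimum H
... | _ , (W , resolving , refl) , _ = bound H G⊆H W resolving

-- The extremal graph

module Extremal (k′ : ℕ) where

  -- Here n = k (2 ^ k + k) - 1, the largest order with `f (+ n / k) ≤ k`. The size `b` is the least
  -- that k landmarks cannot handle.
  k a b n : ℕ
  k = suc k′
  a = 2 ^ k
  b = suc (2 ^ k + k)
  n = a + k′ * b

  n≢0 : NonZero n
  n≢0 = >-nonZero (≤-trans (m^n>0 2 k) (m≤m+n a (k′ * b)))

  colour : Fin n → Fin k
  colour u with splitAt a u
  ... | inj₁ _ = zero
  ... | inj₂ r = suc (quotient b r)

  small : Fin a → Fin n
  small y = y ↑ˡ (k′ * b)

  large : Fin k′ → Fin b → Fin n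
  large i y = a ↑ʳ combine i y

  colour-small : ∀ y → colour (small y) ≡ zero
  colour-small y rewrite Fin.splitAt-↑ˡ a y (k′ * b) = refl

  colour-large : ∀ i y → colour (large i y) ≡ suc i
  colour-large i y rewrite Fin.splitAt-↑ʳ a (k′ * b) (combine i y) =
    cong (suc ∘ proj₁) (Fin.remQuot-combine i y)

  small-injective : ∀ {y z} → small y ≡ small z → y ≡ z
  small-injective = Fin.↑ˡ-injective (k′ * b) _ _

  large-injective : ∀ i {y z} → large i y ≡ large i z → y ≡ z
  large-injective i {y} {z} eq = Fin.combine-injectiveʳ i y i z (Fin.↑ʳ-injective a _ _ eq)

  colour-onto : ∀ i → ∃[ u ] colour u ≡ i
  colour-onto zero    = small y , colour-small y
    where
    y : Fin a
    y = fromℕ< (m^n>0 2 k)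
  colour-onto (suc i) = large i zero , colour-large i zero

  open CompleteMultipartite n≢0 colour public

  -- From k - 1 < 2 ^ (k - 1) it follows that k - 1 landmarks handle fewer than 2 ^ k vertices.
  small-≥ : ∀ w → a ≤ w + 2 ^ w → k ≤ w
  small-≥ w le = ≮⇒≥ λ w<k → <⇒≱ (begin-strict
    w + 2 ^ w         ≤⟨ +-mono-≤ (≤-pred w<k) (^-monoʳ-≤ 2 (≤-pred w<k)) ⟩
    k′ + 2 ^ k′       <⟨ +-monoˡ-< (2 ^ k′) (m<2^m k′) ⟩
    2 ^ k′ + 2 ^ k′   ≡⟨ cong (λ x → 2 ^ k′ + x) (sym (+-identityʳ (2 ^ k′))) ⟩
    a                 ∎) le
    where open ≤-Reasoning

  large-≥ : ∀ w → b ≤ w + 2 ^ w → suc k ≤ w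
  large-≥ w le = ≮⇒≥ λ w<1+k → <⇒≱ (s≤s (≤-trans
    (+-mono-≤ (≤-pred w<1+k) (^-monoʳ-≤ 2 (≤-pred w<1+k)))
    (≤-reflexive (+-comm k (2 ^ k))))) le

  -- With k ≥ 2 every class has a vertex outside it, which serves as a common
  -- neighbour of the vertices of the class.
  resolving-≥ : ∀ {j} → k′ ≡ suc j → ∀ H → multipartite ⊆ᴳ H → ∀ W → Resolving H W →
                k + k′ * suc k ≤ ∣ W ∣
  resolving-≥ refl H G⊆H W resolving = begin
    k + k′ * suc k                   ≤⟨ +-mono-≤ w₀ (∑-≥ (suc k) wᵢ) ⟩
    ∑ w                              ≡⟨ ∑-length-fibre colour (elements W) ⟩
    length (elements W)              ≡⟨ length-elements W ⟩
    ∣ W ∣                            ∎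
    where
    open ≤-Reasoning
    w : Fin k → ℕ
    w = length ∘ fibre colour (elements W)

    joined : ∀ {u v} → colour u ≢ colour v → Adj H u v
    joined ≢ = G⊆H _ _ (multipartite-adj ≢)

    w₀ : k ≤ w zero
    w₀ = small-≥ (w zero) (class-size-≤ H colour joined W resolving zero
           (large zero zero) (λ eq → Fin.0≢1+n (trans (sym eq) (colour-large zero zero)))
           small small-injective colour-small)

    wᵢ : ∀ i → suc k ≤ w (suc i)
    wᵢ i = large-≥ (w (suc i)) (class-size-≤ H colour joined W resolving (suc i)
             (proj₁ (colour-onto zero)) (λ eq → Fin.0≢1+n (trans (sym (proj₂ (colour-onto zero))) eq))
             (large i) (large-injective i) (colour-large i))

  -- Settles k = 1, where the bound is 1 and no vertex lies outside the only class: two distinct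
  -- vertices already require a landmark.
  resolving-nonempty : ∀ (H : Graph n) W → Resolving H W → 1 ≤ ∣ W ∣
  resolving-nonempty H W resolving =
    let w , w∈W , _ = resolving (small y₀) (small y₁) λ eq → <⇒≢ z<s
          (trans (sym (Fin.toℕ-fromℕ< (m^n>0 2 k)))
            (trans (cong toℕ (small-injective eq)) (Fin.toℕ-fromℕ< 1<a)))
    in nonempty w∈W
    where
    1<a : 1 < a
    1<a = ≤-<-trans (s≤s z≤n) (m<2^m k)

    y₀ y₁ : Fin a
    y₀ = fromℕ< (m^n>0 2 k)
    y₁ = fromℕ< 1<a

    nonempty : ∀ {w} → w ∈ˢ W → 1 ≤ ∣ W ∣
    nonempty w∈W = ≤-trans (≤-trans (s≤s z≤n) (Fin.toℕ<n (index (∈-elements w∈W))))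
                           (≤-reflexive (length-elements W))

  τ-lower : k + k′ * suc k ≤ τ multipartite
  τ-lower = ≤-τ {G = multipartite} λ H G⊆H W resolving → by-cases k′ refl H G⊆H W resolving
    where
    by-cases : ∀ j → k′ ≡ j → ∀ H → multipartite ⊆ᴳ H → ∀ W → Resolving H W → k + k′ * suc k ≤ ∣ W ∣
    by-cases zero    refl H G⊆H W resolving = resolving-nonempty H W resolving
    by-cases (suc j) eq   H G⊆H W resolving = resolving-≥ eq H G⊆H W resolving

  χ≡k : χ multipartite ≡ k
  χ≡k = multipartite-χ colour-onto

  -- The strict step has a gap of exactly 1, because n + 1 = k (2 ^ k + k).
  f≤k : f (+ n / k) ≤ k
  f≤k = f-least n k k (begin-strict
    a + k′ * suc (a + k)           ≡⟨ +-*-Solver.solve 3 (λ a j s → a :+ j :* (con 1 :+ s) :=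
                                        a :+ j :+ j :* s) refl a k′ (a + k) ⟩
    a + k′ + k′ * (a + k)          <⟨ +-monoˡ-< _ (+-monoʳ-< a (n<1+n k′)) ⟩
    a + k + k′ * (a + k)           ≡⟨ *-comm k (a + k) ⟩
    (a + k) * k                    ∎)
    where
    open ≤-Reasoning
    open +-*-Solver using (con; _:+_; _:*_; _:=_)

  -- The one-sided estimate `f≤k` closes a cycle of inequalities: the upper bound, monotonicity in
  -- `f`, and the lower bound `τ-lower`.
  τ≡ : τ multipartite ≡ k * (f (+ n / k) + 1) ∸ 1
  τ≡ = ≤-antisym (τ-upper n k multipartite χ≡k) (begin
    k * (f (+ n / k) + 1) ∸ 1   ≤⟨ ∸-monoˡ-≤ 1 (*-monoʳ-≤ k (+-monoˡ-≤ 1 f≤k)) ⟩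
    k * (k + 1) ∸ 1             ≡⟨ cong (λ x → k * x ∸ 1) (+-comm k 1) ⟩
    -- `k * suc k ∸ 1` computes to this, as `k` is `suc k′`.
    k + k′ * suc k              ≤⟨ τ-lower ⟩
    τ multipartite              ∎)
    where open ≤-Reasoning

theorem3p5 : (∀ (n k : ℕ) .{{_ : NonZero k}} (G : Graph n) → χ G ≡ k →
    τ G ≤ k * (f (+ n / k) + 1) ∸ 1)
    ×
    (∀ (k : ℕ) .{{_ : NonZero k}} →
    ∃[ n ] Σ[ G ∈ Graph n ]
    (χ G ≡ k × τ G ≡ k * (f (+ n / k) + 1) ∸ 1))
theorem3p5 = τ-upper , sharp
  where
  sharp : ∀ (k : ℕ) .{{_ : NonZero k}} →
          ∃[ n ] Σ[ G ∈ Graph n ] (χ G ≡ k × τ G ≡ k * (f (+ n / k) + 1) ∸ 1)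
  sharp (suc k′) = n , multipartite , χ≡k , τ≡
    where open Extremal k′
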